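{- Let $d \geq 2$ and let $m_1 \leq m_2 \leq \dots \leq m_d$ be natural numbers. Then $$box(TCC(m_1,m_2,\dots,m_d)) \leq cub(TCC(m_1,m_2,\dots,m_d)) \leq m_1+m_2+\dots+m_{d-1}.$$
   Context: Natural numbers here are positive integers. All graphs are finite, simple and undirected. Boxicity and cubicity: a $k$-box (resp. $k$-cube) is a Cartesian product of $k$ closed intervals (resp. closed unit-length intervals) of $\mathbb{R}$. A $k$-box (resp. $k$-cube) representation of a graph $\Gamma$ is a function $f$ assigning to each vertex a $k$-box (resp. $k$-cube) such that two distinct vertices $u,v$ are adjacent if and only if $f(u)\cap f(v)\neq\emptyset$. The boxicity $box(\Gamma)$ (resp. cubicity $cub(\Gamma)$) is the smallest non-negative integer $k$ for which $\Gamma$ has a $k$-box (resp. $k$-cube) representation; complete graphs have boxicity and cubicity $0$. For positive integers $a_1,\dots,a_s$, $TCC(a_1,\dots,a_s)$ (the transitive closure of the Cartesian product of the complete graphs $K_{a_1+1},\dots,K_{a_s+1}$) is the graph whose vertices are the integer $s$-tuples $x=(x_1,\dots,x_s)$ with $0\leq x_i\leq a_i$ for all $i$, where two distinct vertices $x,y$ are adjacent if and only if either $x_i\leq y_i$ for all $i$, or $x_i\geq y_i$ for all $i$. -}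

module Defs where

open import Level using (0ℓ)
open import Data.Empty using (⊥-elim)
open import Data.Fin using (Fin; zero; suc; toℕ; fromℕ<)
open import Data.Fin.Properties
  using (all?; toℕ-fromℕ<; toℕ-injective; toℕ≤pred[n]; *↔×)
  renaming (_≟_ to _≟ᶠ_)
open import Data.Nat as ℕ using (ℕ; zero; suc; s≤s)
import Data.Nat.Properties as ℕ
open import Data.Nat.Induction using (<-rec)
open import Data.Product using (∃; ∃-syntax; _×_; _,_; proj₁; proj₂)
open import Data.Product.Function.NonDependent.Propositional using (_×-↔_)
open import Data.Rational using (ℚ; 0ℚ; 1ℚ; _+_; _-_; -_)
  renaming (_<_ to _<ℚ_; _≤_ to _≤ℚ_)
import Data.Rational.Properties as ℚ
open import Data.Sum using (_⊎_; inj₁; inj₂; swap)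
open import Data.Vec using (Vec; []; _∷_; lookup)
import Data.Vec.Properties as Vec
open import Function using (_∘_; _⇔_; _↔_; mk⇔; mk↔ₛ′; Inverse)
open import Function.Construct.Composition using (_↔-∘_)
open import Function.Construct.Identity using (↔-id)
open import Function.Construct.Symmetry using (↔-sym)
open import Relation.Binary using (Rel; Decidable; Symmetric; Irreflexive; tri<; tri≈; tri>)
open import Relation.Binary.PropositionalEquality
open import Relation.Nullary using (¬_; Dec; yes; no; ¬?; _×-dec_; _⊎-dec_; recompute)
open import Relation.Nullary.Decidable using (map′; from-yes)

-- Two-sided Dedekind cuts of ℚ.

record ℝ : Set₁ where
  field
    L U         : ℚ → Set
    L-inhabited : ∃ L
    U-inhabited : ∃ U
    L-closed    : ∀ {q r} → q <ℚ r → L r → L q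
    U-closed    : ∀ {q r} → q <ℚ r → U q → U r
    L-open      : ∀ {q} → L q → ∃[ r ] q <ℚ r × L r
    U-open      : ∀ {r} → U r → ∃[ q ] q <ℚ r × U q
    disjoint    : ∀ {q} → ¬ (L q × U q)
    located     : ∀ {q r} → q <ℚ r → L q ⊎ U r

infix 4 _≤ᴿ_ _≃ᴿ_

_≤ᴿ_ : ℝ → ℝ → Set
x ≤ᴿ y = ∀ {q} → ℝ.L x q → ℝ.L y q

_≃ᴿ_ : ℝ → ℝ → Set
x ≃ᴿ y = x ≤ᴿ y × y ≤ᴿ x

private
  sub-add : ∀ p s → (p - s) + s ≡ p
  sub-add p s = trans (ℚ.+-assoc p (- s) s)
    (trans (cong (p +_) (ℚ.+-inverseˡ s)) (ℚ.+-identityʳ p))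

  add-sub : ∀ p s → (p + s) - s ≡ p
  add-sub p s = trans (ℚ.+-assoc p s (- s))
    (trans (cong (p +_) (ℚ.+-inverseʳ s)) (ℚ.+-identityʳ p))

  sub-mono : ∀ s {p q} → p <ℚ q → p - s <ℚ q - s
  sub-mono s = ℚ.+-monoˡ-< (- s)

fromℚ : ℚ → ℝ
fromℚ p = record
  { L = _<ℚ p
  ; U = p <ℚ_
  ; L-inhabited = p - 1ℚ , subst (p - 1ℚ <ℚ_) (ℚ.+-identityʳ p) (ℚ.+-monoʳ-< p (from-yes (- 1ℚ ℚ.<? 0ℚ)))
  ; U-inhabited = p + 1ℚ , subst (_<ℚ p + 1ℚ) (ℚ.+-identityʳ p) (ℚ.+-monoʳ-< p (from-yes (0ℚ ℚ.<? 1ℚ)))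
  ; L-closed = ℚ.<-trans
  ; U-closed = λ q<r p<q → ℚ.<-trans p<q q<r
  ; L-open = λ q<p → let r , q<r , r<p = ℚ.<-dense q<p in r , q<r , r<p
  ; U-open = λ p<r → let q , p<q , q<r = ℚ.<-dense p<r in q , q<r , p<q
  ; disjoint = λ (q<p , p<q) → ℚ.<-asym q<p p<q
  ; located = located
  }
  where
  located : ∀ {q r} → q <ℚ r → q <ℚ p ⊎ p <ℚ r
  located {q} q<r with ℚ.<-cmp q p
  ... | tri< q<p _ _ = inj₁ q<p
  ... | tri≈ _ refl _ = inj₂ q<r
  ... | tri> _ _ p<q = inj₂ (ℚ.<-trans p<q q<r)

infixl 6 _+ℚ_

_+ℚ_ : ℝ → ℚ → ℝ
x +ℚ s = record
  { L = λ q → X.L (q - s)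
  ; U = λ q → X.U (q - s)
  ; L-inhabited = let q , l = X.L-inhabited in q + s , subst X.L (sym (add-sub q s)) l
  ; U-inhabited = let q , u = X.U-inhabited in q + s , subst X.U (sym (add-sub q s)) u
  ; L-closed = X.L-closed ∘ sub-mono s
  ; U-closed = X.U-closed ∘ sub-mono s
  ; L-open = λ {q} l → let r , q<r , l′ = X.L-open l in
      r + s , subst (_<ℚ r + s) (sub-add q s) (ℚ.+-monoˡ-< s q<r)
            , subst X.L (sym (add-sub r s)) l′
  ; U-open = λ {r} u → let q , q<r , u′ = X.U-open u in
      q + s , subst (q + s <ℚ_) (sub-add r s) (ℚ.+-monoˡ-< s q<r)
            , subst X.U (sym (add-sub q s)) u′
  ; disjoint = X.disjoint
  ; located = X.located ∘ sub-mono s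
  }
  where module X = ℝ x

record Interval : Set₁ where
  field
    left right : ℝ
    left≤right : left ≤ᴿ right

infix 4 _∈ᴵ_ _∈ᴮ_

_∈ᴵ_ : ℝ → Interval → Set
x ∈ᴵ I = Interval.left I ≤ᴿ x × x ≤ᴿ Interval.right I

UnitLength : Interval → Set
UnitLength I = Interval.right I ≃ᴿ Interval.left I +ℚ 1ℚ

Box : ℕ → Set₁
Box k = Fin k → Interval

_∈ᴮ_ : ∀ {k} → (Fin k → ℝ) → Box k → Set
p ∈ᴮ B = ∀ i → p i ∈ᴵ B i

IsCube : ∀ {k} → Box k → Set
IsCube B = ∀ i → UnitLength (B i)

Meets : ∀ {k} → Box k → Box k → Set₁
Meets A B = ∃[ p ] (p ∈ᴮ A × p ∈ᴮ B)

record FiniteGraph : Set₁ where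
  field
    Vertex : Set
    size   : ℕ
    enum   : Vertex ↔ Fin size
    Adj    : Rel Vertex 0ℓ
    adj?   : Decidable Adj
    symm   : Symmetric Adj
    irrefl : Irreflexive _≡_ Adj

module _ (Γ : FiniteGraph) where
  open FiniteGraph Γ

  Represents : ∀ {k} → (Vertex → Box k) → Set₁
  Represents f = ∀ u v → u ≢ v → Adj u v ⇔ Meets (f u) (f v)

  HasBoxRep : ℕ → Set₁
  HasBoxRep k = ∃[ f ] Represents {k} f

  HasCubeRep : ℕ → Set₁
  HasCubeRep k = ∃[ f ] (∀ v → IsCube (f v)) × Represents {k} f

IsLeast : (ℕ → Set₁) → ℕ → Set₁
IsLeast P k = P k × (∀ j → P j → k ℕ.≤ j)

IsBoxicity : FiniteGraph → ℕ → Set₁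
IsBoxicity Γ = IsLeast (HasBoxRep Γ)

IsCubicity : FiniteGraph → ℕ → Set₁
IsCubicity Γ = IsLeast (HasCubeRep Γ)

-- The field `bounded` is irrelevant so that vertices with equal coordinates
-- are propositionally equal.
record Tuple {s} (a : Vec ℕ s) : Set where
  constructor mkTuple
  field
    coords   : Vec ℕ s
    .bounded : ∀ i → lookup coords i ℕ.≤ lookup a i

open Tuple public

infix 4 _≼_

_≼_ : ∀ {s} {a : Vec ℕ s} → Rel (Tuple a) 0ℓ
x ≼ y = ∀ i → lookup (coords x) i ℕ.≤ lookup (coords y) i

private
  coords-injective : ∀ {s} {a : Vec ℕ s} {x y : Tuple a} → coords x ≡ coords y → x ≡ y
  coords-injective refl = refl

  _≟ᵀ_ : ∀ {s} {a : Vec ℕ s} → Decidable {A = Tuple a} _≡_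
  x ≟ᵀ y = map′ coords-injective (cong coords) (Vec.≡-dec ℕ._≟_ (coords x) (coords y))

  _≼?_ : ∀ {s} {a : Vec ℕ s} → Decidable (_≼_ {a = a})
  x ≼? y = all? λ i → lookup (coords x) i ℕ.≤? lookup (coords y) i

  tuple-∷ : ∀ {s} a₀ (a : Vec ℕ s) → Tuple (a₀ ∷ a) ↔ (Fin (suc a₀) × Tuple a)
  tuple-∷ a₀ a = mk↔ₛ′ to from to-from from-to
    where
    bound : ∀ {x} → .(x ℕ.≤ a₀) → x ℕ.< suc a₀
    bound {x} x≤ = s≤s (recompute (x ℕ.≤? a₀) x≤)

    to : Tuple (a₀ ∷ a) → Fin (suc a₀) × Tuple a
    to (mkTuple (x ∷ xs) b) = fromℕ< (bound (b zero)) , mkTuple xs (b ∘ suc)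

    from : Fin (suc a₀) × Tuple a → Tuple (a₀ ∷ a)
    from (i , mkTuple xs b) = mkTuple (toℕ i ∷ xs) λ { zero → toℕ≤pred[n] i ; (suc j) → b j }

    to-from : ∀ p → to (from p) ≡ p
    to-from (i , mkTuple xs b) = cong (_, mkTuple xs b) (toℕ-injective (toℕ-fromℕ< _))

    from-to : ∀ x → from (to x) ≡ x
    from-to (mkTuple (x ∷ xs) b) = coords-injective (cong (_∷ xs) (toℕ-fromℕ< _))

  tuple-finite : ∀ {s} (a : Vec ℕ s) → ∃[ n ] (Tuple a ↔ Fin n)
  tuple-finite [] = 1 , mk↔ₛ′ (λ _ → zero) (λ _ → mkTuple [] λ ())
    (λ { zero → refl }) (λ { (mkTuple [] _) → refl })
  tuple-finite (a₀ ∷ a) =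
    let n , e = tuple-finite a in
    suc a₀ ℕ.* n , ↔-sym *↔× ↔-∘ ((↔-id _ ×-↔ e) ↔-∘ tuple-∷ a₀ a)

TCC : ∀ {s} → Vec ℕ s → FiniteGraph
TCC a = record
  { Vertex = Tuple a
  ; size   = proj₁ (tuple-finite a)
  ; enum   = proj₂ (tuple-finite a)
  ; Adj    = λ x y → x ≢ y × (x ≼ y ⊎ y ≼ x)
  ; adj?   = λ x y → ¬? (x ≟ᵀ y) ×-dec ((x ≼? y) ⊎-dec (y ≼? x))
  ; symm   = λ (x≢y , c) → x≢y ∘ sym , swap c
  ; irrefl = λ x≡y (x≢y , _) → x≢y x≡y
  }

-- A nonempty set of naturals has a least element only up to double negation
-- constructively.  The remaining lemmas show that, in this sense, boxicity and
-- cubicity exist for every finite graph, so that `IsBoxicity Γ` and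
-- `IsCubicity Γ` are never empty hypotheses; they also determine their
-- arguments uniquely.

IsLeast-unique : ∀ {P j k} → IsLeast P j → IsLeast P k → j ≡ k
IsLeast-unique (pj , minj) (pk , mink) = ℕ.≤-antisym (minj _ pk) (mink _ pj)

IsLeast-exists : ∀ {P n} → P n → ¬ ¬ ∃ (IsLeast P)
IsLeast-exists {P} {n} pn none = <-rec (λ k → ¬ P k) step n pn
  where
  step : ∀ k → (∀ {j} → j ℕ.< k → ¬ P j) → ¬ P k
  step k below pk = none (k , pk , λ j pj → ℕ.≮⇒≥ λ j<k → below j<k pj)

cube⇒box : ∀ Γ {k} → HasCubeRep Γ k → HasBoxRep Γ k
cube⇒box Γ (f , _ , r) = f , r

-- One coordinate per vertex w: left end 0 at w, 1 at the neighbours of w,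
-- and 2 elsewhere.
hasCubeRep : ∀ Γ → HasCubeRep Γ (FiniteGraph.size Γ)
hasCubeRep Γ = f , (λ v i → cube (pos v i)) , λ u v u≢v → mk⇔ (meet u v) (adj u v u≢v)
  where
  open FiniteGraph Γ
  open Inverse enum using (to; from; strictlyInverseʳ)

  data Pos : Set where
    self near far : Pos

  ⟦_⟧ : Pos → ℚ
  ⟦ self ⟧ = 0ℚ
  ⟦ near ⟧ = 1ℚ
  ⟦ far  ⟧ = 1ℚ + 1ℚ

  embed : ∀ {p q} → p ≤ℚ q → fromℚ p ≤ᴿ fromℚ q
  embed p≤q r<p = ℚ.<-≤-trans r<p p≤q

  interval : Pos → Interval
  interval a = record
    { left       = fromℚ ⟦ a ⟧
    ; right      = fromℚ (⟦ a ⟧ + 1ℚ)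
    ; left≤right = embed (≤+1 a)
    }
    where
    ≤+1 : ∀ a → ⟦ a ⟧ ≤ℚ ⟦ a ⟧ + 1ℚ
    ≤+1 self = from-yes (0ℚ ℚ.≤? 0ℚ + 1ℚ)
    ≤+1 near = from-yes (1ℚ ℚ.≤? 1ℚ + 1ℚ)
    ≤+1 far  = from-yes (1ℚ + 1ℚ ℚ.≤? 1ℚ + 1ℚ + 1ℚ)

  cube : ∀ a → UnitLength (interval a)
  cube a = (λ {q} q<a+1 → subst (q - 1ℚ <ℚ_) (add-sub ⟦ a ⟧ 1ℚ) (sub-mono 1ℚ q<a+1))
         , (λ {q} q-1<a → subst (_<ℚ ⟦ a ⟧ + 1ℚ) (sub-add q 1ℚ) (ℚ.+-monoˡ-< 1ℚ q-1<a))

  position : ∀ {A B : Set} → Dec A → Dec B → Pos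
  position (yes _) _       = self
  position (no _)  (yes _) = near
  position (no _)  (no _)  = far

  pos : Vertex → Fin size → Pos
  pos v i = position (to v ≟ᶠ i) (adj? v (from i))

  f : Vertex → Box size
  f v i = interval (pos v i)

  Apart : Pos → Pos → Set
  Apart a b = (a ≡ self × b ≡ far) ⊎ (a ≡ far × b ≡ self)

  _∩_ : Pos → Pos → Set₁
  a ∩ b = ∃[ p ] p ∈ᴵ interval a × p ∈ᴵ interval b

  common : ∀ a b → ¬ Apart a b → a ∩ b
  common a b ¬apart = go a b ¬apart
    where
    at : ∀ p {a b} → ⟦ a ⟧ ≤ℚ p × p ≤ℚ ⟦ a ⟧ + 1ℚ → ⟦ b ⟧ ≤ℚ p × p ≤ℚ ⟦ b ⟧ + 1ℚ → a ∩ b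
    at p (l , r) (l′ , r′) = fromℚ p , (embed l , embed r) , (embed l′ , embed r′)

    self∋1 = from-yes ((0ℚ ℚ.≤? 1ℚ) ×-dec (1ℚ ℚ.≤? 0ℚ + 1ℚ))
    near∋1 = from-yes ((1ℚ ℚ.≤? 1ℚ) ×-dec (1ℚ ℚ.≤? 1ℚ + 1ℚ))
    near∋2 = from-yes ((1ℚ ℚ.≤? 1ℚ + 1ℚ) ×-dec (1ℚ + 1ℚ ℚ.≤? 1ℚ + 1ℚ))
    far∋2  = from-yes ((1ℚ + 1ℚ ℚ.≤? 1ℚ + 1ℚ) ×-dec (1ℚ + 1ℚ ℚ.≤? 1ℚ + 1ℚ + 1ℚ))

    go : ∀ a b → ¬ Apart a b → a ∩ b
    go self self _ = at 1ℚ {self} {self} self∋1 self∋1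
    go self near _ = at 1ℚ {self} {near} self∋1 near∋1
    go self far  h = ⊥-elim (h (inj₁ (refl , refl)))
    go near self _ = at 1ℚ {near} {self} near∋1 self∋1
    go near near _ = at 1ℚ {near} {near} near∋1 near∋1
    go near far  _ = at (1ℚ + 1ℚ) {near} {far} near∋2 far∋2
    go far  self h = ⊥-elim (h (inj₂ (refl , refl)))
    go far  near _ = at (1ℚ + 1ℚ) {far} {near} far∋2 near∋2
    go far  far  _ = at (1ℚ + 1ℚ) {far} {far} far∋2 far∋2

  self∩far : ¬ (self ∩ far)
  self∩far (p , (_ , p≤1) , (2≤p , _)) =
    ℚ.<-irrefl refl (p≤1 (2≤p {1ℚ} (from-yes (1ℚ ℚ.<? 1ℚ + 1ℚ))))

  apart⇒¬adj : ∀ u v i → pos u i ≡ self → pos v i ≡ far → ¬ Adj u v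
  apart⇒¬adj u v i eq eq′ uv with to u ≟ᶠ i
  apart⇒¬adj u v i refl eq′ uv | yes refl with to v ≟ᶠ to u | adj? v (from (to u))
  apart⇒¬adj u v i refl () uv | yes refl | yes _ | _
  apart⇒¬adj u v i refl () uv | yes refl | no _ | yes _
  apart⇒¬adj u v i refl eq′ uv | yes refl | no _ | no ¬vu =
    ¬vu (subst (Adj v) (sym (strictlyInverseʳ u)) (symm uv))
  apart⇒¬adj u v i eq eq′ uv | no _ with adj? u (from i)
  apart⇒¬adj u v i () eq′ uv | no _ | yes _
  apart⇒¬adj u v i () eq′ uv | no _ | no _

  meet : ∀ u v → Adj u v → Meets (f u) (f v)
  meet u v uv = (λ i → proj₁ (pt i)) , (λ i → proj₁ (proj₂ (pt i))) , (λ i → proj₂ (proj₂ (pt i)))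
    where
    pt : ∀ i → pos u i ∩ pos v i
    pt i = common (pos u i) (pos v i) λ
      { (inj₁ (eq , eq′)) → apart⇒¬adj u v i eq eq′ uv
      ; (inj₂ (eq , eq′)) → apart⇒¬adj v u i eq′ eq (symm uv) }

  self-pos : ∀ u → pos u (to u) ≡ self
  self-pos u with to u ≟ᶠ to u
  ... | yes _ = refl
  ... | no ≢  = ⊥-elim (≢ refl)

  far-pos : ∀ u v → u ≢ v → ¬ Adj u v → pos v (to u) ≡ far
  far-pos u v u≢v ¬uv with to v ≟ᶠ to u | adj? v (from (to u))
  ... | yes eq | _ = ⊥-elim (u≢v (trans (sym (strictlyInverseʳ u))
                       (trans (cong from (sym eq)) (strictlyInverseʳ v))))
  ... | no _ | yes vu = ⊥-elim (¬uv (symm (subst (Adj v) (strictlyInverseʳ u) vu)))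
  ... | no _ | no _   = refl

  adj : ∀ u v → u ≢ v → Meets (f u) (f v) → Adj u v
  adj u v u≢v (p , p∈u , p∈v) with adj? u v
  ... | yes uv = uv
  ... | no ¬uv = ⊥-elim (self∩far (p (to u)
        , subst (λ a → p (to u) ∈ᴵ interval a) (self-pos u) (p∈u (to u))
        , subst (λ a → p (to u) ∈ᴵ interval a) (far-pos u v u≢v ¬uv) (p∈v (to u))))

cubicity-exists : ∀ Γ → ¬ ¬ ∃ (IsCubicity Γ)
cubicity-exists Γ = IsLeast-exists (hasCubeRep Γ)

boxicity-exists : ∀ Γ → ¬ ¬ ∃ (IsBoxicity Γ)
boxicity-exists Γ = IsLeast-exists (cube⇒box Γ (hasCubeRep Γ))

{-# OPTIONS --safe #-}
-- Fix the colexicographic rank on tuples.  For a coordinate j < d and a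
-- threshold t < mⱼ, place x at (normalised rank of x) ∈ [0,1], shifted by 1
-- when xⱼ ≤ t.  Comparable tuples then lie within distance 1.  If x and y are
-- incomparable and rank x < rank y, then y_j < x_j for some j, and j is not the
-- last coordinate because that one dominates the rank; in the dimension (j, yⱼ)
-- only y is shifted, so x and y are more than 1 apart.  There are
-- m₁ + … + m_{d-1} pairs (j, t).
module Submission where

open import Defs
open import Data.Nat using (ℕ; _+_; _≤_)
open import Data.Fin as Fin using (Fin)
open import Data.Vec using (Vec; lookup; init; sum)
open import Data.Product using (_×_)

open import Data.Fin using (zero; suc; fromℕ; fromℕ<; toℕ; inject₁; splitAt; _↑ˡ_; _↑ʳ_)
open import Data.Fin.Properties using (splitAt-↑ˡ; splitAt-↑ʳ; toℕ-fromℕ<)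
open import Data.Fin.Relation.Unary.Top using (view; ‵fromℕ; ‵inject₁)
open import Data.Integer as ℤ using (+_)
import Data.Integer.Properties as ℤ
open import Data.Nat as ℕ using (_*_; _<_; z≤n; s≤s)
import Data.Nat.Properties as ℕ
open import Data.Product using (∃-syntax; _,_; proj₁; proj₂; map₁)
open import Data.Rational as ℚ using (ℚ; 0ℚ; 1ℚ)
import Data.Rational.Properties as ℚ
open import Data.Rational.Unnormalised as ℚᵘ using (mkℚᵘ; 0ℚᵘ; 1ℚᵘ; *≤*; *<*)
import Data.Rational.Unnormalised.Properties as ℚᵘ
open import Data.Sum using (_⊎_; inj₁; inj₂; [_,_]′)
open import Data.Vec using ([]; _∷_)
open import Function using (_∘_; _⇔_; mk⇔; Equivalence)
open import Relation.Binary using (tri<; tri≈; tri>)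
open import Relation.Binary.PropositionalEquality
open import Relation.Nullary using (¬_; yes; no; recompute; contradiction)
open import Relation.Nullary.Decidable using (from-yes)

-- Unit cubes with rational corners.

p≤p+1 : ∀ p → p ℚ.≤ p ℚ.+ 1ℚ
p≤p+1 p = subst (ℚ._≤ p ℚ.+ 1ℚ) (ℚ.+-identityʳ p)
  (ℚ.+-monoʳ-≤ p (from-yes (0ℚ ℚ.≤? 1ℚ)))

fromℚ-mono : ∀ {p q} → p ℚ.≤ q → fromℚ p ≤ᴿ fromℚ q
fromℚ-mono p≤q r<p = ℚ.<-≤-trans r<p p≤q

fromℚ-cancel : ∀ {p q} → fromℚ p ≤ᴿ fromℚ q → p ℚ.≤ q
fromℚ-cancel p≤q = ℚ.≮⇒≥ λ q<p → ℚ.<-irrefl refl (p≤q q<p)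

unitInterval : ℚ → Interval
unitInterval p = record
  { left       = fromℚ p
  ; right      = fromℚ (p ℚ.+ 1ℚ)
  ; left≤right = fromℚ-mono (p≤p+1 p)
  }

∈-unitInterval : ∀ {p z} → p ℚ.≤ z → z ℚ.≤ p ℚ.+ 1ℚ → fromℚ z ∈ᴵ unitInterval p
∈-unitInterval p≤z z≤p+1 = fromℚ-mono p≤z , fromℚ-mono z≤p+1

unitInterval-unit : ∀ p → UnitLength (unitInterval p)
unitInterval-unit p =
    (λ {q} q<p+1 → subst (q ℚ.- 1ℚ ℚ.<_) (add-sub p) (ℚ.+-monoˡ-< (ℚ.- 1ℚ) q<p+1))
  , (λ {q} q-1<p → subst (ℚ._< p ℚ.+ 1ℚ) (sub-add q) (ℚ.+-monoˡ-< 1ℚ q-1<p))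
  where
  add-sub : ∀ r → r ℚ.+ 1ℚ ℚ.- 1ℚ ≡ r
  add-sub r = trans (ℚ.+-assoc r 1ℚ (ℚ.- 1ℚ)) (ℚ.+-identityʳ r)

  sub-add : ∀ r → r ℚ.- 1ℚ ℚ.+ 1ℚ ≡ r
  sub-add r = trans (ℚ.+-assoc r (ℚ.- 1ℚ) 1ℚ) (ℚ.+-identityʳ r)

-- In each dimension a common point lies between either left end and the other right end, which
-- gives both inequalities. Conversely, the larger of the two left ends lies in both intervals.
unitCubes-meet : ∀ {k} (p q : Fin k → ℚ) →
  Meets (unitInterval ∘ p) (unitInterval ∘ q) ⇔
  (∀ i → p i ℚ.≤ q i ℚ.+ 1ℚ × q i ℚ.≤ p i ℚ.+ 1ℚ)
unitCubes-meet p q = mk⇔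
  (λ (z , z∈p , z∈q) i →
      fromℚ-cancel (proj₂ (z∈q i) ∘ proj₁ (z∈p i))
    , fromℚ-cancel (proj₂ (z∈p i) ∘ proj₁ (z∈q i)))
  (λ close → (λ i → fromℚ (p i ℚ.⊔ q i))
    , (λ i → ∈-unitInterval (ℚ.p≤p⊔q (p i) (q i)) (ℚ.⊔-lub (p≤p+1 (p i)) (proj₂ (close i))))
    , (λ i → ∈-unitInterval (ℚ.p≤q⊔p (p i) (q i)) (ℚ.⊔-lub (proj₁ (close i)) (p≤p+1 (q i)))))

-- Leaves only rational lower corners to choose, so that Dedekind cuts do not enter the rest of the
-- argument.
unitCubeRep : ∀ Γ {k} (p : FiniteGraph.Vertex Γ → Fin k → ℚ) →
  (∀ u v → u ≢ v →
    FiniteGraph.Adj Γ u v ⇔ (∀ i → p u i ℚ.≤ p v i ℚ.+ 1ℚ × p v i ℚ.≤ p u i ℚ.+ 1ℚ)) →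
  HasCubeRep Γ k
unitCubeRep Γ p adj⇔close =
    (λ v → unitInterval ∘ p v)
  , (λ v i → unitInterval-unit (p v i))
  , (λ u v u≢v → mk⇔
      (from (unitCubes-meet (p u) (p v)) ∘ to (adj⇔close u v u≢v))
      (from (adj⇔close u v u≢v) ∘ to (unitCubes-meet (p u) (p v))))
  where open Equivalence using (to; from)

-- Fractions over a common denominator.

fromℚᵘ-mono-≤ : ∀ p q → p ℚᵘ.≤ q → ℚ.fromℚᵘ p ℚ.≤ ℚ.fromℚᵘ q
fromℚᵘ-mono-≤ p q p≤q = ℚ.toℚᵘ-cancel-≤ (begin
  ℚ.toℚᵘ (ℚ.fromℚᵘ p)  ≃⟨ ℚ.toℚᵘ-fromℚᵘ p ⟩
  p                    ≤⟨ p≤q ⟩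
  q                    ≃⟨ ℚ.toℚᵘ-fromℚᵘ q ⟨
  ℚ.toℚᵘ (ℚ.fromℚᵘ q)  ∎)
  where open ℚᵘ.≤-Reasoning

fromℚᵘ-mono-< : ∀ p q → p ℚᵘ.< q → ℚ.fromℚᵘ p ℚ.< ℚ.fromℚᵘ q
fromℚᵘ-mono-< p q p<q = ℚ.toℚᵘ-cancel-< (begin-strict
  ℚ.toℚᵘ (ℚ.fromℚᵘ p)  ≃⟨ ℚ.toℚᵘ-fromℚᵘ p ⟩
  p                    <⟨ p<q ⟩
  q                    ≃⟨ ℚ.toℚᵘ-fromℚᵘ q ⟨
  ℚ.toℚᵘ (ℚ.fromℚᵘ q)  ∎)
  where open ℚᵘ.≤-Reasoning

-- The denominator is suc k, as in mkℚᵘ.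
fraction : ℕ → ℕ → ℚ
fraction k n = ℚ.fromℚᵘ (mkℚᵘ (+ n) k)

fraction-mono-≤ : ∀ k {a b} → a ≤ b → fraction k a ℚ.≤ fraction k b
fraction-mono-≤ k {a} {b} a≤b = fromℚᵘ-mono-≤ (mkℚᵘ (+ a) k) (mkℚᵘ (+ b) k)
  (*≤* (ℤ.*-monoʳ-≤-nonNeg (+ ℕ.suc k) (ℤ.+≤+ a≤b)))

fraction-mono-< : ∀ k {a b} → a < b → fraction k a ℚ.< fraction k b
fraction-mono-< k {a} {b} a<b = fromℚᵘ-mono-< (mkℚᵘ (+ a) k) (mkℚᵘ (+ b) k)
  (*<* (ℤ.*-monoʳ-<-pos (+ ℕ.suc k) (ℤ.+<+ a<b)))

0≤fraction : ∀ k n → 0ℚ ℚ.≤ fraction k n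
0≤fraction k n = fromℚᵘ-mono-≤ 0ℚᵘ (mkℚᵘ (+ n) k) (ℚᵘ.nonNegative⁻¹ (mkℚᵘ (+ n) k))

fraction≤1 : ∀ k {n} → n ≤ ℕ.suc k → fraction k n ℚ.≤ 1ℚ
fraction≤1 k {n} n≤1+k = fromℚᵘ-mono-≤ (mkℚᵘ (+ n) k) 1ℚᵘ (*≤* (begin
  + n ℤ.* + 1        ≡⟨ ℤ.*-identityʳ (+ n) ⟩
  + n                ≤⟨ ℤ.+≤+ n≤1+k ⟩
  + ℕ.suc k          ≡⟨ ℤ.*-identityˡ (+ ℕ.suc k) ⟨
  + 1 ℤ.* + ℕ.suc k  ∎))
  where open ℤ.≤-Reasoning

-- Colexicographic rank as a mixed-radix numeral, least significant digit first.

rank : ∀ {s} → Vec ℕ s → Vec ℕ s → ℕ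
rank []       []       = 0
rank (a ∷ as) (x ∷ xs) = x + ℕ.suc a * rank as xs

rank-mono : ∀ {s} (a x y : Vec ℕ s) →
  (∀ i → lookup x i ≤ lookup y i) → rank a x ≤ rank a y
rank-mono []       []       []       _   = z≤n
rank-mono (a ∷ as) (x ∷ xs) (y ∷ ys) x≤y =
  ℕ.+-mono-≤ (x≤y zero) (ℕ.*-monoʳ-≤ (ℕ.suc a) (rank-mono as xs ys (x≤y ∘ suc)))

-- The digit `x` stays below the base `suc a`, while passing from `p` to `q` gains at least one full
-- base.
carry-< : ∀ {a x p q} y → x ≤ a → p < q → x + ℕ.suc a * p < y + ℕ.suc a * q
carry-< {a} {x} {p} {q} y x≤a p<q = begin-strict
  x + ℕ.suc a * p           <⟨ ℕ.+-monoˡ-< (ℕ.suc a * p) (s≤s x≤a) ⟩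
  ℕ.suc a + ℕ.suc a * p     ≡⟨ ℕ.*-suc (ℕ.suc a) p ⟨
  ℕ.suc a * ℕ.suc p         ≤⟨ ℕ.*-monoʳ-≤ (ℕ.suc a) p<q ⟩
  ℕ.suc a * q               ≤⟨ ℕ.m≤n+m (ℕ.suc a * q) y ⟩
  y + ℕ.suc a * q           ∎
  where open ℕ.≤-Reasoning

rank-last-< : ∀ {s} (a x y : Vec ℕ (ℕ.suc s)) → (∀ i → lookup x i ≤ lookup a i) →
  lookup x (fromℕ s) < lookup y (fromℕ s) → rank a x < rank a y
rank-last-< {ℕ.zero} (a ∷ []) (x ∷ []) (y ∷ []) _ x<y =
  ℕ.+-monoˡ-< (ℕ.suc a * 0) x<y
rank-last-< {ℕ.suc s} (a ∷ as) (x ∷ xs) (y ∷ ys) x≤a x<y =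
  carry-< y (x≤a zero) (rank-last-< as xs ys (x≤a ∘ suc) x<y)

-- Tails of unequal rank would separate the ranks by `carry-<`; otherwise the tail terms cancel and
-- the heads agree. This settles ties: tuples of equal rank have equal coordinates, hence are
-- comparable.
rank-injective : ∀ {s} (a x y : Vec ℕ s) →
  (∀ i → lookup x i ≤ lookup a i) → (∀ i → lookup y i ≤ lookup a i) →
  rank a x ≡ rank a y → x ≡ y
rank-injective []       []       []       _   _   _  = refl
rank-injective (a ∷ as) (x ∷ xs) (y ∷ ys) x≤a y≤a eq
  with ℕ.<-cmp (rank as xs) (rank as ys)
... | tri< lt _ _ = contradiction eq (ℕ.<⇒≢ (carry-< y (x≤a zero) lt))
... | tri> _ _ gt = contradiction (sym eq) (ℕ.<⇒≢ (carry-< x (y≤a zero) gt))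
... | tri≈ _ tails-≡ _ = cong₂ _∷_
  (ℕ.+-cancelʳ-≡ (ℕ.suc a * rank as ys) x y
    (trans (cong (λ r → x + ℕ.suc a * r) (sym tails-≡)) eq))
  (rank-injective as xs ys (x≤a ∘ suc) (y≤a ∘ suc) tails-≡)

-- Thresholds and shifts.

threshold : ∀ {s} (m : Vec ℕ s) → Fin (sum m) → Fin s × ℕ
threshold (a ∷ as) i =
  [ (λ t → zero , toℕ t) , (λ i′ → map₁ suc (threshold as i′)) ]′ (splitAt a i)

-- `threshold` cuts the index range into consecutive blocks, the one for `j` of length `lookup m j`,
-- and `t` is a position in its block. Surjectivity supplies a dimension for every pair that has to
-- separate two tuples.
threshold-onto : ∀ {s} (m : Vec ℕ s) j {t} → t < lookup m j →
  ∃[ i ] threshold m i ≡ (j , t)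
threshold-onto (a ∷ as) zero t<a = fromℕ< t<a ↑ˡ sum as ,
  trans (cong [ _ , _ ]′ (splitAt-↑ˡ a (fromℕ< t<a) (sum as)))
        (cong (zero ,_) (toℕ-fromℕ< t<a))
threshold-onto (a ∷ as) (suc j) t<m =
  let i , eq = threshold-onto as j t<m in
  a ↑ʳ i , trans (cong [ _ , _ ]′ (splitAt-↑ʳ a (sum as) i)) (cong (map₁ suc) eq)

lookup-init : ∀ {A : Set} {s} (xs : Vec A (ℕ.suc s)) j →
  lookup (init xs) j ≡ lookup xs (inject₁ j)
lookup-init (x ∷ y ∷ xs) zero    = refl
lookup-init (x ∷ y ∷ xs) (suc j) = lookup-init (y ∷ xs) j

shift : ℕ → ℕ → ℚ
shift t x with x ℕ.≤? t
... | yes _ = 1ℚ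
... | no  _ = 0ℚ

shift-≤ : ∀ {t x} → x ≤ t → shift t x ≡ 1ℚ
shift-≤ {t} {x} x≤t with x ℕ.≤? t
... | yes _  = refl
... | no x≰t = contradiction x≤t x≰t

shift-> : ∀ {t x} → t < x → shift t x ≡ 0ℚ
shift-> {t} {x} t<x with x ℕ.≤? t
... | yes x≤t = contradiction x≤t (ℕ.<⇒≱ t<x)
... | no _    = refl

0≤shift : ∀ t x → 0ℚ ℚ.≤ shift t x
0≤shift t x with x ℕ.≤? t
... | yes _ = from-yes (0ℚ ℚ.≤? 1ℚ)
... | no _  = ℚ.≤-refl

shift≤1 : ∀ t x → shift t x ℚ.≤ 1ℚ
shift≤1 t x with x ℕ.≤? t
... | yes _ = ℚ.≤-refl
... | no _  = from-yes (0ℚ ℚ.≤? 1ℚ)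

shift-antitone : ∀ t {x y} → x ≤ y → shift t y ℚ.≤ shift t x
shift-antitone t {x} {y} x≤y with y ℕ.≤? t
... | yes y≤t = ℚ.≤-reflexive (sym (shift-≤ (ℕ.≤-trans x≤y y≤t)))
... | no _    = 0≤shift t x

-- The cube representation of `TCC m`.

module _ {s} (m : Vec ℕ (ℕ.suc s)) where

  private
    bound : ∀ (x : Tuple m) i → lookup (coords x) i ≤ lookup m i
    bound (mkTuple x x≤m) i = recompute (lookup x i ℕ.≤? lookup m i) (x≤m i)

  -- `rank m m` is the largest rank and `fraction` divides by its successor, so heights lie in
  -- [0,1).
  height : Tuple m → ℚ
  height x = fraction (rank m m) (rank m (coords x))

  offset : Tuple m → Fin s × ℕ → ℚ
  offset x (j , t) = shift t (lookup (coords x) (inject₁ j))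

  position : Tuple m → Fin (sum (init m)) → ℚ
  position x i = height x ℚ.+ offset x (threshold (init m) i)

  height-mono : ∀ x y → x ≼ y → height x ℚ.≤ height y
  height-mono x y x≼y =
    fraction-mono-≤ (rank m m) (rank-mono m (coords x) (coords y) x≼y)

  height≤1 : ∀ x → height x ℚ.≤ 1ℚ
  height≤1 x = fraction≤1 (rank m m)
    (ℕ.m≤n⇒m≤1+n (rank-mono m (coords x) m (bound x)))

  -- First inequality: the heights are already in order, and the offset of `x` adds at most 1.
  -- Second: wherever `y` is shifted so is `x`, and the heights differ by at most 1.
  comparable⇒close : ∀ x y → x ≼ y → ∀ i →
    position x i ℚ.≤ position y i ℚ.+ 1ℚ × position y i ℚ.≤ position x i ℚ.+ 1ℚ
  comparable⇒close x y x≼y i =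
    let j , t = threshold (init m) i in
      (begin
        height x ℚ.+ offset x (j , t)         ≤⟨ ℚ.+-mono-≤ (height-mono x y x≼y) (shift≤1 t (lookup (coords x) (inject₁ j))) ⟩
        height y ℚ.+ 1ℚ                       ≡⟨ cong (ℚ._+ 1ℚ) (ℚ.+-identityʳ (height y)) ⟨
        height y ℚ.+ 0ℚ ℚ.+ 1ℚ                ≤⟨ ℚ.+-monoˡ-≤ 1ℚ (ℚ.+-monoʳ-≤ (height y) (0≤shift t (lookup (coords y) (inject₁ j)))) ⟩
        height y ℚ.+ offset y (j , t) ℚ.+ 1ℚ  ∎)
    , (begin
        height y ℚ.+ offset y (j , t)         ≤⟨ ℚ.+-mono-≤ (height≤1 y) (shift-antitone t (x≼y (inject₁ j))) ⟩
        1ℚ ℚ.+ offset x (j , t)               ≡⟨ ℚ.+-comm 1ℚ (offset x (j , t)) ⟩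
        offset x (j , t) ℚ.+ 1ℚ               ≡⟨ cong (ℚ._+ 1ℚ) (ℚ.+-identityˡ (offset x (j , t))) ⟨
        0ℚ ℚ.+ offset x (j , t) ℚ.+ 1ℚ        ≤⟨ ℚ.+-monoˡ-≤ 1ℚ (ℚ.+-monoˡ-≤ (offset x (j , t)) (0≤fraction (rank m m) (rank m (coords x)))) ⟩
        height x ℚ.+ offset x (j , t) ℚ.+ 1ℚ  ∎)
    where open ℚ.≤-Reasoning

  close⇒≼ : ∀ x y → (∀ i → position y i ℚ.≤ position x i ℚ.+ 1ℚ) →
    rank m (coords x) < rank m (coords y) → x ≼ y
  close⇒≼ x y close x<y c = ℕ.≮⇒≥ (not-above c)
    where
    not-above : ∀ c → ¬ lookup (coords y) c < lookup (coords x) c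
    not-above c y<x with view c
    ... | ‵fromℕ = ℕ.<-asym x<y (rank-last-< m (coords y) (coords x) (bound y) y<x)
    ... | ‵inject₁ j = ℚ.<-irrefl refl (ℚ.<-≤-trans far (close i))
      where
      open ℚ.≤-Reasoning

      -- `shift` compares non-strictly, so at its own entry `y` is shifted, while `x`, strictly
      -- above it, is not.
      t = lookup (coords y) (inject₁ j)

      hit : ∃[ i ] threshold (init m) i ≡ (j , t)
      -- The threshold is in range because the entry of `y` is below that of `x`, which is at most
      -- that of `m`.
      hit = threshold-onto (init m) j
        (subst (t <_) (sym (lookup-init m j)) (ℕ.<-≤-trans y<x (bound x (inject₁ j))))

      i = proj₁ hit

      offset-at : ∀ z → offset z (threshold (init m) i) ≡ offset z (j , t)
      offset-at z = cong (offset z) (proj₂ hit)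

      far : position x i ℚ.+ 1ℚ ℚ.< position y i
      far = begin-strict
        position x i ℚ.+ 1ℚ      ≡⟨ cong (λ o → height x ℚ.+ o ℚ.+ 1ℚ) (trans (offset-at x) (shift-> y<x)) ⟩
        height x ℚ.+ 0ℚ ℚ.+ 1ℚ   ≡⟨ cong (ℚ._+ 1ℚ) (ℚ.+-identityʳ (height x)) ⟩
        -- Strictness of the rank order is essential: closed unit intervals at distance exactly 1
        -- still meet.
        height x ℚ.+ 1ℚ          <⟨ ℚ.+-monoˡ-< 1ℚ (fraction-mono-< (rank m m) x<y) ⟩
        height y ℚ.+ 1ℚ          ≡⟨ cong (height y ℚ.+_) (trans (offset-at y) (shift-≤ {t} ℕ.≤-refl)) ⟨
        position y i             ∎

  TCC-cubeRep : HasCubeRep (TCC m) (sum (init m))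
  TCC-cubeRep = unitCubeRep (TCC m) position λ x y x≢y → mk⇔
    (λ { (_ , inj₁ x≼y) i → comparable⇒close x y x≼y i
       ; (_ , inj₂ y≼x) i → let yx , xy = comparable⇒close y x y≼x i in xy , yx })
    (λ close → x≢y , comparable x y close)
    where
    comparable : ∀ x y →
      (∀ i → position x i ℚ.≤ position y i ℚ.+ 1ℚ × position y i ℚ.≤ position x i ℚ.+ 1ℚ) →
      x ≼ y ⊎ y ≼ x
    comparable x y close with ℕ.<-cmp (rank m (coords x)) (rank m (coords y))
    ... | tri< x<y _ _ = inj₁ (close⇒≼ x y (proj₂ ∘ close) x<y)
    ... | tri> _ _ y<x = inj₂ (close⇒≼ y x (proj₁ ∘ close) y<x)
    ... | tri≈ _ x≡y _ = inj₁ λ i → ℕ.≤-reflexive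
      (cong (λ v → lookup v i) (rank-injective m (coords x) (coords y) (bound x) (bound y) x≡y))

theorem1 : (n : ℕ) (m : Vec ℕ (2 + n)) →
    (∀ i → 1 ≤ lookup m i) →
    (∀ i j → i Fin.≤ j → lookup m i ≤ lookup m j) →
    ∀ box cub → IsBoxicity (TCC m) box → IsCubicity (TCC m) cub →
    box ≤ cub × cub ≤ sum (init m)
theorem1 n m _ _ box cub (_ , box-least) (cubeRep , cub-least) =
  -- A cube representation is in particular a box representation, so minimality of `box` applies to
  -- `cub`.
  box-least cub (cube⇒box (TCC m) cubeRep) , cub-least (sum (init m)) (TCC-cubeRep m)
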